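{- Let $\sigma$ be a permutation and let $\omega\in\Sigma^*$ be a decomposition of $\sigma$ on $\Sigma=\{t_i: i\in\mathbb{N}^*\}$. The bubblian decomposition of $\sigma$ is obtained from $\omega$ by applying repeatedly the following rules, in which $i,j,k$ are arbitrary positive integers and $\omega$ is a word on $\Sigma$: (P1) $t_i\,t_i\longrightarrow 1$; (P2) if $\mathrm{Dist}(i+1,\omega)>1$, then $t_{i+1}\,\omega\,t_i\,t_{i+1}\longrightarrow \omega\,t_i\,t_{i+1}\,t_i$; (P3) if $\mathrm{Dist}(i,\omega)>1$ and $\omega$ is maximally increasing, then $\omega\,t_i\longrightarrow t_i\,\omega$; (P4) if $\mathrm{Dist}(j,k\omega)>1$ and either $i\le j\le k$ or $k<i\le j$, then $t_i\,t_k\,\omega\,t_j\longrightarrow t_i\,t_j\,t_k\,\omega$.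
   Context: $t_i$ is the transposition that swaps the elements in positions $i$ and $i+1$ of a list. $\Sigma=\{t_i: i\in\mathbb{N}^*\}$ generates the group of permutations; $\Sigma^*$ is the set of finite words on $\Sigma$, $1$ the empty word. A word $t_{i_1}\cdots t_{i_k}$ represents the product permutation (acting on lists as a composition of operators, the rightmost letter acting first). For words $\omega_1,\omega_2$, $\mathrm{Dist}(\omega_1,\omega_2)=\min\{|i-j|: t_i \text{ in }\omega_1, t_j\text{ in }\omega_2\}$ (infinite if one word is empty); $\mathrm{Dist}(i,\omega)$ means $\mathrm{Dist}(t_i,\omega)$ and $\mathrm{Dist}(j,k\omega)$ means $\mathrm{Dist}(t_j,t_k\omega)$. A word $t_{i_1}\cdots t_{i_k}$ is increasing if $i_1<i_2<\dots<i_k$. Every word factors uniquely as $\omega_1\omega_2\cdots\omega_m$ with each $\omega_p$ a nonempty increasing word that is maximal (it cannot be extended to the left or right inside the word to a longer increasing factor); this is its increasing decomposition $[\omega_1,\dots,\omega_m]$. In (P3), "maximally increasing" means that $\omega$ is such a maximal increasing factor of the word being rewritten. Rules are applied to factors of words; applying them repeatedly means until no rule can be applied. Bubble sort: the algorithm compares the elements in positions 1 and 2 and swaps them if they are in the wrong order, then positions 2 and 3, and so on to the end of the list; this whole process is iterated until no changes are done. For a permutation $\sigma$ of $[1,\dots,n]$, the bubblian decomposition of $\sigma$ is the word $\omega=t_{i_1}t_{i_2}\cdots t_{i_k}$ such that bubble sort run on the list $\sigma[1,\dots,n]$ performs successively the swaps $t_{i_1},t_{i_2},\dots,t_{i_k}$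 (so $\omega^{ -1}\sigma=1$).
   Formalization: Applying the rules need not stop in every order (t3 t1 t3 → t3 t3 t1 → t3 t1 t3 by P4, P3); what is proved: from every word reachable from ω some run ends at the bubblian decomposition, no rule applies to it, and every run that stops ends there. -}

module Defs where

open import Data.Bool.Base using (if_then_else_)
open import Data.Fin.Base using (Fin; toℕ)
open import Data.Fin.Permutation using (Permutation′; _⟨$⟩ʳ_; _⟨$⟩ˡ_)
open import Data.List.Base
  using (List; []; _∷_; _++_; [_]; tabulate; foldr; cartesianProductWith)
import Data.List.Extrema as Extrema
open import Data.List.Relation.Unary.Linked using (Linked)
open import Data.Nat.Base using (ℕ; zero; suc; _≤_; _<_; ∣_-_∣)
open import Data.Nat.Properties using (_<?_; ≤-isTotalOrder)
open import Data.Product.Base using (_×_; _,_; proj₁; proj₂)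
open import Data.Sum.Base using (_⊎_)
open import Function.Base using (id; _∘_)
open import Relation.Binary.Bundles using (TotalOrder)
import Relation.Binary.Construct.Add.Supremum.NonStrict as AddSupremum
open import Relation.Binary.Construct.Add.Supremum.Strict _<_ using (_<⁺_)
open import Relation.Binary.PropositionalEquality.Core using (_≡_; _≢_)
open import Relation.Nullary.Construct.Add.Supremum
  using (_⁺; ⊤⁺) renaming ([_] to fin)
open import Relation.Nullary.Decidable.Core using (does)

------------------------------------------------------------------------
-- Words and permutations

-- Positions are counted from 0, so the letter i : ℕ stands for the
-- transposition written t_{i+1} when positions are counted from 1.  All
-- conditions on indices below are invariant under this shift.

Letter : Set
Letter = ℕ

Word : Set
Word = List Letter

transposition : Letter → ℕ → ℕ
transposition zero    zero          = 1
transposition zero    (suc zero)    = 0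
transposition zero    (suc (suc x)) = suc (suc x)
transposition (suc i) zero          = zero
transposition (suc i) (suc x)       = suc (transposition i x)

-- The product permutation of a word; the rightmost letter acts first.

⟦_⟧ : Word → ℕ → ℕ
⟦_⟧ = foldr (λ i f → transposition i ∘ f) id

-- Letters of ω may move positions outside the range of σ (as in
-- t₉ t₉ = 1), so σ is compared as a permutation of ℕ fixing every m ≥ n.

_IsDecompositionOf_ : Word → ∀ {n} → Permutation′ n → Set
_IsDecompositionOf_ ω {n} σ =
  (∀ (x : Fin n) → ⟦ ω ⟧ (toℕ x) ≡ toℕ (σ ⟨$⟩ʳ x)) ×
  (∀ m → n ≤ m → ⟦ ω ⟧ m ≡ m)

-- The list σ[1,…,n].  A permutation acts on a list by moving the element
-- in position x to position σ x.  This is the action for which a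
-- transposition swaps the elements in its two positions and a product of
-- permutations acts as the composition of the operators, hence the
-- inverse of σ in the formula for the entries.

permutedList : ∀ {n} → Permutation′ n → List ℕ
permutedList σ = tabulate (λ j → suc (toℕ (σ ⟨$⟩ˡ j)))

------------------------------------------------------------------------
-- Bubble sort

-- bubblePass p x xs runs one pass over x ∷ xs, where x is in position p.
-- It returns the letters of the swaps done, in order, and the new list.

bubblePass : ℕ → ℕ → List ℕ → Word × List ℕ
bubblePass p x []       = [] , [ x ]
bubblePass p x (y ∷ ys) =
  if does (y <? x)
  then (let ω , zs = bubblePass (suc p) x ys in p ∷ ω , y ∷ zs)
  else (let ω , zs = bubblePass (suc p) y ys in ω , x ∷ zs)

pass : List ℕ → Word × List ℕ
pass []       = [] , []
pass (x ∷ xs) = bubblePass 0 x xs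

-- BubbleSort xs ω: bubble sort run on xs terminates, and ω is the
-- sequence of swaps it performs.

data BubbleSort : List ℕ → Word → Set where
  stop    : ∀ {xs} → proj₁ (pass xs) ≡ [] → BubbleSort xs []
  iterate : ∀ {xs ω} → proj₁ (pass xs) ≢ [] →
            BubbleSort (proj₂ (pass xs)) ω →
            BubbleSort xs (proj₁ (pass xs) ++ ω)

_IsBubblianDecompositionOf_ : Word → ∀ {n} → Permutation′ n → Set
ω IsBubblianDecompositionOf σ = BubbleSort (permutedList σ) ω

------------------------------------------------------------------------
-- Distance between words

ℕ∞-totalOrder : TotalOrder _ _ _
ℕ∞-totalOrder = record
  { isTotalOrder = AddSupremum.≤⁺-isTotalOrder-≡ _≤_ ≤-isTotalOrder }

Dist : Word → Word → ℕ ⁺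
Dist ω₁ ω₂ = Extrema.min ℕ∞-totalOrder ⊤⁺
  (cartesianProductWith (λ i j → fin ∣ i - j ∣) ω₁ ω₂)

infix 4 _>1

_>1 : ℕ ⁺ → Set
d >1 = fin 1 <⁺ d

------------------------------------------------------------------------
-- Increasing factors

Increasing : Word → Set
Increasing = Linked _<_

-- ω is a maximal increasing factor of the word u ++ ω ++ v, at this place.

record MaximallyIncreasing (u ω v : Word) : Set where
  field
    nonempty   : ω ≢ []
    increasing : Increasing ω
    maximal    : ∀ u′ x y v′ → u ≡ u′ ++ x → v ≡ y ++ v′ →
                 Increasing (x ++ ω ++ y) → x ≡ [] × y ≡ []

------------------------------------------------------------------------
-- The rewriting rules, applied to a factor of a word u ++ … ++ v

infix 4 _⟶_

data _⟶_ : Word → Word → Set where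

  P1 : ∀ u v i →
       u ++ (i ∷ i ∷ []) ++ v ⟶ u ++ v

  P2 : ∀ u v i ω → Dist [ suc i ] ω >1 →
       u ++ (suc i ∷ ω ++ i ∷ suc i ∷ []) ++ v ⟶
       u ++ (ω ++ i ∷ suc i ∷ i ∷ []) ++ v

  P3 : ∀ u v i ω → Dist [ i ] ω >1 → MaximallyIncreasing u ω (i ∷ v) →
       u ++ (ω ++ [ i ]) ++ v ⟶ u ++ (i ∷ ω) ++ v

  P4 : ∀ u v i j k ω → Dist [ j ] (k ∷ ω) >1 →
       (i ≤ j × j ≤ k) ⊎ (k < i × i ≤ j) →
       u ++ (i ∷ k ∷ ω ++ [ j ]) ++ v ⟶ u ++ (i ∷ j ∷ k ∷ ω) ++ v

{-# OPTIONS --safe #-}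
-- Bubble sort produces words P₀ P₁ … P_r of increasing passes in which j ∈ P_{q+1}
-- implies j + 1 ∈ P_q; call them staircases.  Appending a letter to a
-- staircase, the rules either reach a staircase again or decrease the sum of
-- the letters, so every word rewrites to a staircase.  Conversely a
-- staircase is the bubblian decomposition of the permutation it represents:
-- undoing a pass S on a list whose entries outside S are left-to-right
-- maxima yields a list on which bubble sort swaps exactly at S.  Hence a
-- permutation has only one staircase, which is reachable from each of its
-- decompositions.  It is normal: P1 and P2 would make the letter sum
-- drop below that of the staircase reached afterwards, and the support of
-- each letter by the previous pass leaves no redex for P3 and P4.
module Submission where

open import Defs
open import Data.Empty using (⊥)
open import Data.Fin.Base using (Fin; toℕ) renaming (zero to fzero; suc to fsuc)
open import Data.Fin.Permutation using (Permutation′; _⟨$⟩ˡ_; inverseʳ)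
open import Data.List.Base using (List; []; _∷_; _++_; [_]; map; tabulate; initLast; _∷ʳ′_)
import Data.List.Extrema as Extrema
open import Data.List.Membership.Propositional using (_∈_; _∉_)
open import Data.List.Membership.Propositional.Properties using (∈-++⁺ˡ; ∈-++⁺ʳ; ∈-++⁻; ∈-∃++)
open import Data.List.Properties
  using (++-assoc; ++-identityʳ; ++-conicalʳ; ∷-injective; ∷-injectiveˡ; map-++; ∷ʳ-injective)
open import Data.List.Relation.Binary.Permutation.Propositional using (_↭_; prep; ↭-sym)
import Data.List.Relation.Binary.Permutation.Propositional.Properties as Perm
open import Data.List.Relation.Binary.Subset.Propositional using (_⊆_)
open import Data.List.Relation.Unary.All as All using (All; []; _∷_)
import Data.List.Relation.Unary.All.Properties as All
open import Data.List.Relation.Unary.AllPairs using (AllPairs; []; _∷_)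
import Data.List.Relation.Unary.AllPairs.Properties as AllPairs
open import Data.List.Relation.Unary.Any using (here; there)
open import Data.List.Relation.Unary.Linked.Properties using (AllPairs⇒Linked; Linked⇒AllPairs)
open import Data.Nat.Base using (ℕ; zero; suc; _+_; _≤_; _<_; z≤n; s≤s; z<s; s<s; s≤s⁻¹; ∣_-_∣)
open import Data.Nat.Induction using (<-wellFounded)
open import Data.Nat.ListAction using (sum)
open import Data.Nat.ListAction.Properties using (sum-++; sum-↭)
open import Data.Nat.Properties
open import Data.List.Membership.DecPropositional _≟_ using (_∈?_)
open import Data.Product.Base using (∃-syntax; _×_; _,_; proj₁; proj₂)
open import Data.Sum.Base using (_⊎_; inj₁; inj₂; [_,_]′)
open import Data.Unit.Base using (⊤; tt)
open import Function.Base using (_∘_; id)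
open import Induction.WellFounded using (Acc; acc)
import Relation.Binary.Construct.Add.Supremum.NonStrict _≤_ as NonStrict
import Relation.Binary.Construct.Add.Supremum.Strict _<_ as Strict
open import Relation.Binary.Construct.Closure.ReflexiveTransitive using (Star; ε; _◅_; _◅◅_; gmap; fold)
open import Relation.Binary.Definitions using (tri<; tri≈; tri>)
open import Relation.Binary.PropositionalEquality
  using (_≡_; _≢_; refl; sym; trans; cong; cong₂; subst; subst₂; module ≡-Reasoning)
open import Relation.Binary.Rewriting using (IsNormalForm)
open import Relation.Nullary using (¬_; contradiction; yes; no)
open import Relation.Nullary.Construct.Add.Supremum using (⊤⁺) renaming ([_] to fin)
open import Relation.Nullary.Decidable using (dec-true; dec-false)

private
  variable
    i j k m n x : ℕ
    f g : ℕ → ℕ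
    u v w w′ ω ρ : Word
    A B C D N P Q S : Word
    Ps Qs : List Word

module _ {A : Set} where

  ++-assoc₃ : (a b c d : List A) → (a ++ b ++ c) ++ d ≡ a ++ b ++ c ++ d
  ++-assoc₃ a b c d = trans (++-assoc a (b ++ c) d) (cong (a ++_) (++-assoc b c d))

  AllPairs-++⁻ : {R : A → A → Set} (xs : List A) {ys : List A} → AllPairs R (xs ++ ys) →
                 AllPairs R xs × AllPairs R ys × All (λ x → All (R x) ys) xs
  AllPairs-++⁻ []       rs       = [] , rs , []
  AllPairs-++⁻ (x ∷ xs) (r ∷ rs) with AllPairs-++⁻ xs rs | All.++⁻ xs r
  ... | rs₁ , rs₂ , rs₁₂ | r₁ , r₂ = r₁ ∷ rs₁ , rs₂ , r₂ ∷ rs₁₂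

-- Increasing words and commuting letters

Sorted : Word → Set
Sorted = AllPairs _<_

sorted⇒increasing : Sorted ω → Increasing ω
sorted⇒increasing = AllPairs⇒Linked

increasing⇒sorted : Increasing ω → Sorted ω
increasing⇒sorted = Linked⇒AllPairs <-trans

Apart : ℕ → ℕ → Set
Apart i x = suc i < x ⊎ suc x < i

Far : Letter → Word → Set
Far i = All (Apart i)

apart⇒>1 : ∀ i x → Apart i x → 1 < ∣ i - x ∣
apart⇒>1 zero    x       (inj₁ p) = p
apart⇒>1 (suc i) zero    (inj₂ p) = p
apart⇒>1 (suc i) (suc x) (inj₁ p) = apart⇒>1 i x (inj₁ (s≤s⁻¹ p))
apart⇒>1 (suc i) (suc x) (inj₂ p) = apart⇒>1 i x (inj₂ (s≤s⁻¹ p))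

>1⇒apart : ∀ i x → 1 < ∣ i - x ∣ → Apart i x
>1⇒apart zero    x       p = inj₁ p
>1⇒apart (suc i) zero    p = inj₂ p
>1⇒apart (suc i) (suc x) p with >1⇒apart i x p
... | inj₁ q = inj₁ (s≤s q)
... | inj₂ q = inj₂ (s≤s q)

far⇒dist>1 : ∀ i ω → Far i ω → Dist [ i ] ω >1
far⇒dist>1 i ω far = strict (v≤min⁺ far)
  where
  open Extrema ℕ∞-totalOrder hiding (v≤min⁺)
  open NonStrict using (_≤⁺_; _≤⊤⁺)
  strict : ∀ {d} → fin 2 ≤⁺ d → d >1
  strict NonStrict.[ p ] = Strict.[ p ]
  strict (_ ≤⊤⁺)        = Strict.[ 1 ]<⊤⁺
  distances : ∀ {ω} → Far i ω → All (λ d → fin 2 ≤⁺ d) (map (λ x → fin ∣ i - x ∣) ω)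
  distances []       = []
  distances (p ∷ ps) = NonStrict.[ apart⇒>1 i _ p ] ∷ distances ps
  v≤min⁺ : Far i ω → fin 2 ≤⁺ Dist [ i ] ω
  v≤min⁺ far = v≤f[argmin]⁺ {f = id} (_ ≤⊤⁺)
    -- A product with the singleton `[ i ]` is one row of distances followed by an empty list.
    (subst (All _) (sym (++-identityʳ _)) (distances far))

dist>1⇒far : ∀ i ω → Dist [ i ] ω >1 → Far i ω
dist>1⇒far i ω dist = distances ω (subst (All _) (++-identityʳ _) (f[argmin]≤f[xs] {f = id} ⊤⁺ _))
  where
  open Extrema ℕ∞-totalOrder
  open NonStrict using (_≤⁺_; _≤⊤⁺)
  >1-≤ : ∀ {d n} → d >1 → d ≤⁺ fin n → 1 < n
  >1-≤ Strict.[ p ] NonStrict.[ q ] = ≤-trans p q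
  distances : ∀ ω′ → All (Dist [ i ] ω ≤⁺_) (map (λ x → fin ∣ i - x ∣) ω′) → Far i ω′
  distances []       _        = []
  distances (x ∷ ω′) (p ∷ ps) = >1⇒apart i x (>1-≤ dist p) ∷ distances ω′ ps

suc∈⇒¬far : suc i ∈ ω → ¬ Far i ω
suc∈⇒¬far i∈ω far with All.lookup far i∈ω
... | inj₁ p = <-irrefl refl p
... | inj₂ p = <-asym p (m<n⇒m<1+n ≤-refl)

-- Action of transpositions and words on positions

transposition-involutive : ∀ i x → transposition i (transposition i x) ≡ x
transposition-involutive zero    zero          = refl
transposition-involutive zero    (suc zero)    = refl
transposition-involutive zero    (suc (suc x)) = refl
transposition-involutive (suc i) zero          = refl
transposition-involutive (suc i) (suc x)       = cong suc (transposition-involutive i x)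

transposition-comm : ∀ i j → Apart i j → ∀ x →
  transposition i (transposition j x) ≡ transposition j (transposition i x)
transposition-comm zero (suc (suc j)) p zero          = refl
transposition-comm zero (suc (suc j)) p (suc zero)    = refl
transposition-comm zero (suc (suc j)) p (suc (suc x)) = refl
transposition-comm zero (suc zero) (inj₁ (s<s ())) x
transposition-comm zero zero (inj₁ ()) x
transposition-comm zero zero (inj₂ ()) x
transposition-comm (suc (suc i)) zero p zero          = refl
transposition-comm (suc (suc i)) zero p (suc zero)    = refl
transposition-comm (suc (suc i)) zero p (suc (suc x)) = refl
transposition-comm (suc zero) zero (inj₂ (s<s ())) x
transposition-comm (suc i) (suc j) p zero = refl
transposition-comm (suc i) (suc j) (inj₁ p) (suc x) =
  cong suc (transposition-comm i j (inj₁ (s≤s⁻¹ p)) x)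
transposition-comm (suc i) (suc j) (inj₂ p) (suc x) =
  cong suc (transposition-comm i j (inj₂ (s≤s⁻¹ p)) x)

transposition-braid : ∀ i x →
  transposition (suc i) (transposition i (transposition (suc i) x)) ≡
  transposition i (transposition (suc i) (transposition i x))
transposition-braid zero zero                = refl
transposition-braid zero (suc zero)          = refl
transposition-braid zero (suc (suc zero))    = refl
transposition-braid zero (suc (suc (suc x))) = refl
transposition-braid (suc i) zero             = refl
transposition-braid (suc i) (suc x)          = cong suc (transposition-braid i x)

transposition-left : ∀ i → transposition i i ≡ suc i
transposition-left zero    = refl
transposition-left (suc i) = cong suc (transposition-left i)

transposition-right : ∀ i → transposition i (suc i) ≡ i
transposition-right zero    = refl
transposition-right (suc i) = cong suc (transposition-right i)

transposition-below : ∀ i x → x < i → transposition i x ≡ x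
transposition-below (suc i) zero    p = refl
transposition-below (suc i) (suc x) p = cong suc (transposition-below i x (s≤s⁻¹ p))

transposition-above : ∀ i x → suc i < x → transposition i x ≡ x
transposition-above zero    (suc (suc x)) p = refl
transposition-above zero    (suc zero) (s<s ())
transposition-above (suc i) (suc x)       p = cong suc (transposition-above i x (s≤s⁻¹ p))

-- Only the transposition `m` exchanges a position at most `m` with one above it.
transposition-≤ : ∀ i m x → i ≢ m → x ≤ m → transposition i x ≤ m
transposition-≤ zero    zero    x             i≢m p = contradiction refl i≢m
transposition-≤ zero    (suc m) zero          i≢m p = s≤s z≤n
transposition-≤ zero    (suc m) (suc zero)    i≢m p = z≤n
transposition-≤ zero    (suc m) (suc (suc x)) i≢m p = p
transposition-≤ (suc i) m       zero          i≢m p = z≤n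
transposition-≤ (suc i) (suc m) (suc x)       i≢m p =
  s≤s (transposition-≤ i m x (i≢m ∘ cong suc) (s≤s⁻¹ p))

transposition-> : ∀ i m x → i ≢ m → m < x → m < transposition i x
transposition-> i m x i≢m m<x with m <? transposition i x
... | yes p = p
... | no ¬p = contradiction m<x
  (≤⇒≯ (subst (_≤ m) (transposition-involutive i x) (transposition-≤ i m _ i≢m (≮⇒≥ ¬p))))

infix 4 _≗ʷ_

_≗ʷ_ : Word → Word → Set
w ≗ʷ w′ = ∀ x → ⟦ w ⟧ x ≡ ⟦ w′ ⟧ x

⟦++⟧ : ∀ w w′ x → ⟦ w ++ w′ ⟧ x ≡ ⟦ w ⟧ (⟦ w′ ⟧ x)
⟦++⟧ []      w′ x = refl
⟦++⟧ (i ∷ w) w′ x = cong (transposition i) (⟦++⟧ w w′ x)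

⟦⟧-congˡ : ∀ u → w ≗ʷ w′ → u ++ w ≗ʷ u ++ w′
⟦⟧-congˡ []      eq x = eq x
⟦⟧-congˡ (i ∷ u) eq x = cong (transposition i) (⟦⟧-congˡ u eq x)

⟦⟧-congʳ : ∀ w w′ v → w ≗ʷ w′ → w ++ v ≗ʷ w′ ++ v
⟦⟧-congʳ w w′ v eq x = begin
  ⟦ w ++ v ⟧ x         ≡⟨ ⟦++⟧ w v x ⟩
  ⟦ w ⟧ (⟦ v ⟧ x)      ≡⟨ eq _ ⟩
  ⟦ w′ ⟧ (⟦ v ⟧ x)     ≡⟨ ⟦++⟧ w′ v x ⟨
  ⟦ w′ ++ v ⟧ x        ∎
  where open ≡-Reasoning

⟦⟧-far : Far i ω → i ∷ ω ≗ʷ ω ++ [ i ]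
⟦⟧-far                 []       x = refl
⟦⟧-far {i} {ω = j ∷ ω} (p ∷ ps) x =
  trans (transposition-comm i j p (⟦ ω ⟧ x)) (cong (transposition j) (⟦⟧-far ps x))

⟦⟧-braid : Far (suc i) ω → suc i ∷ ω ++ i ∷ suc i ∷ [] ≗ʷ ω ++ i ∷ suc i ∷ i ∷ []
⟦⟧-braid {i} {ω} far x = begin
  ⟦ (suc i ∷ ω) ++ i ∷ suc i ∷ [] ⟧ x       ≡⟨ ⟦⟧-congʳ (suc i ∷ ω) (ω ++ [ suc i ]) _ (⟦⟧-far far) x ⟩
  ⟦ (ω ++ [ suc i ]) ++ i ∷ suc i ∷ [] ⟧ x  ≡⟨ cong (λ w → ⟦ w ⟧ x) (++-assoc ω _ _) ⟩
  ⟦ ω ++ suc i ∷ i ∷ suc i ∷ [] ⟧ x         ≡⟨ ⟦⟧-congˡ ω (transposition-braid i) x ⟩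
  ⟦ ω ++ i ∷ suc i ∷ i ∷ [] ⟧ x             ∎
  where open ≡-Reasoning

⟶-sound : w ⟶ w′ → w ≗ʷ w′
⟶-sound (P1 u v i) = ⟦⟧-congˡ u (λ x → transposition-involutive i _)
⟶-sound (P2 u v i ω d) = ⟦⟧-congˡ u
  (⟦⟧-congʳ (suc i ∷ ω ++ i ∷ suc i ∷ []) (ω ++ i ∷ suc i ∷ i ∷ []) v (⟦⟧-braid (dist>1⇒far _ ω d)))
⟶-sound (P3 u v i ω d _) = ⟦⟧-congˡ u
  (⟦⟧-congʳ (ω ++ [ i ]) (i ∷ ω) v (sym ∘ ⟦⟧-far (dist>1⇒far i ω d)))
⟶-sound (P4 u v i j k ω d _) = ⟦⟧-congˡ u
  (⟦⟧-congˡ {k ∷ (ω ++ [ j ]) ++ v} {j ∷ k ∷ ω ++ v} [ i ]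
    (⟦⟧-congʳ (k ∷ ω ++ [ j ]) (j ∷ k ∷ ω) v (sym ∘ ⟦⟧-far (dist>1⇒far j (k ∷ ω) d))))

-- Rewriting sequences and the weight of a word

infix 4 _⟶*_

_⟶*_ : Word → Word → Set
_⟶*_ = Star _⟶_

⟶*-sound : w ⟶* w′ → w ≗ʷ w′
⟶*-sound = fold _≗ʷ_ (λ s eq x → trans (⟶-sound s x) (eq x)) (λ x → refl)

-- The suc makes deleting a pair of letters 0 decrease the weight.

weight : Word → ℕ
weight w = sum (map suc w)

weight-++ : ∀ w w′ → weight (w ++ w′) ≡ weight w + weight w′
weight-++ w w′ = trans (cong sum (map-++ suc w w′)) (sum-++ (map suc w) (map suc w′))

weight-↭ : w ↭ w′ → weight w ≡ weight w′
weight-↭ p = sum-↭ (Perm.map⁺ suc p)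

weight-mono-< : ∀ u v → weight w < weight w′ → weight (u ++ w ++ v) < weight (u ++ w′ ++ v)
weight-mono-< {w} {w′} u v w<w′ = begin-strict
  weight (u ++ w ++ v)               ≡⟨ expand w ⟩
  weight u + (weight w + weight v)   <⟨ +-monoʳ-< (weight u) (+-monoˡ-< (weight v) w<w′) ⟩
  weight u + (weight w′ + weight v)  ≡⟨ expand w′ ⟨
  weight (u ++ w′ ++ v)              ∎
  where
  open ≤-Reasoning
  expand : ∀ w → weight (u ++ w ++ v) ≡ weight u + (weight w + weight v)
  expand w = trans (weight-++ u _) (cong (weight u +_) (weight-++ w v))

weight-cancel : ∀ u v i → weight (u ++ v) < weight (u ++ (i ∷ i ∷ []) ++ v)
weight-cancel u v i = weight-mono-< {[]} {i ∷ i ∷ []} u v z<s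

weight-braid : ∀ u v i ω →
  weight (u ++ (ω ++ i ∷ suc i ∷ i ∷ []) ++ v) < weight (u ++ (suc i ∷ ω ++ i ∷ suc i ∷ []) ++ v)
weight-braid u v i ω = weight-mono-< {ω ++ i ∷ suc i ∷ i ∷ []} {suc i ∷ ω ++ i ∷ suc i ∷ []} u v
  (begin-strict
    weight (ω ++ i ∷ suc i ∷ i ∷ [])     <⟨ ++-mono (i ∷ suc i ∷ i ∷ []) (suc i ∷ i ∷ suc i ∷ []) lt ⟩
    weight (ω ++ suc i ∷ i ∷ suc i ∷ []) ≡⟨ weight-↭ (Perm.shift (suc i) ω _) ⟩
    weight (suc i ∷ ω ++ i ∷ suc i ∷ []) ∎)
  where
  open ≤-Reasoning
  ++-mono : ∀ a b → weight a < weight b → weight (ω ++ a) < weight (ω ++ b)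
  ++-mono a b lt = subst₂ _<_ (sym (weight-++ ω a)) (sym (weight-++ ω b)) (+-monoʳ-< (weight ω) lt)
  lt : weight (i ∷ suc i ∷ i ∷ []) < weight (suc i ∷ i ∷ suc i ∷ [])
  lt = +-mono-<-≤ {suc i} {suc (suc i)} ≤-refl (begin
    suc (suc i) + (suc i + 0) ≡⟨ cong (suc (suc i) +_) (+-identityʳ _) ⟩
    suc (suc i) + suc i       ≡⟨ +-comm (suc (suc i)) (suc i) ⟩
    suc i + suc (suc i)       ≡⟨ cong (suc i +_) (+-identityʳ _) ⟨
    suc i + (suc (suc i) + 0) ∎)

⟶-weight : w ⟶ w′ → weight w′ ≤ weight w
⟶-weight (P1 u v i)     = <⇒≤ (weight-cancel u v i)
⟶-weight (P2 u v i ω _) = <⇒≤ (weight-braid u v i ω)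
⟶-weight (P3 u v i ω _ _) = ≤-reflexive (weight-↭ (Perm.++⁺ˡ u (Perm.++⁺ʳ v (Perm.∷↭∷ʳ i ω))))
⟶-weight (P4 u v i j k ω _ _) = ≤-reflexive
  (weight-↭ (Perm.++⁺ˡ u (prep i (Perm.++⁺ʳ v (Perm.∷↭∷ʳ j (k ∷ ω))))))

⟶*-weight : w ⟶* w′ → weight w′ ≤ weight w
⟶*-weight = fold (λ w w′ → weight w′ ≤ weight w) (λ s le → ≤-trans le (⟶-weight s)) ≤-refl

-- Rewriting is compatible with appending a suffix only: a prefix may
-- destroy the maximality required by P3.

⟶-++ : ∀ s → w ⟶ w′ → w ++ s ⟶ w′ ++ s
⟶-++ s (P1 u v i) =
  subst₂ _⟶_ (sym (++-assoc₃ u _ v s)) (sym (++-assoc u v s)) (P1 u (v ++ s) i)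
⟶-++ s (P2 u v i ω d) = subst₂ _⟶_ (sym (++-assoc₃ u (suc i ∷ ω ++ i ∷ suc i ∷ []) v s))
  (sym (++-assoc₃ u (ω ++ i ∷ suc i ∷ i ∷ []) v s)) (P2 u (v ++ s) i ω d)
⟶-++ s (P3 u v i ω d m) =
  subst₂ _⟶_ (sym (++-assoc₃ u (ω ++ [ i ]) v s)) (sym (++-assoc₃ u (i ∷ ω) v s))
    (P3 u (v ++ s) i ω d record
      { nonempty   = nonempty
      ; increasing = increasing
      ; maximal    = maximal′
      })
  where
  open MaximallyIncreasing m
  maximal′ : ∀ u′ x y v′ → u ≡ u′ ++ x → i ∷ v ++ s ≡ y ++ v′ →
             Increasing (x ++ ω ++ y) → x ≡ [] × y ≡ []
  maximal′ u′ x []      v′ eq _   inc = maximal u′ x [] (i ∷ v) eq refl inc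
  -- However far an extension to the right reaches into `s`, it starts with `i`, which was there
  -- before `s` was appended; so `ω ++ [ i ]` would already be increasing, against `m`.
  maximal′ u′ x (j ∷ y) v′ eq eq′ inc with ∷-injectiveˡ eq′
  ... | refl with AllPairs-++⁻ x (increasing⇒sorted inc)
  ... | _ , inc′ , _ with AllPairs-++⁻ ω inc′
  ... | incω , _ , ω<y = contradiction
    (proj₂ (maximal u [] [ i ] v (sym (++-identityʳ u)) refl
      (sorted⇒increasing (AllPairs.++⁺ incω ([] ∷ []) (All.map (λ p → All.head p ∷ []) ω<y)))))
    λ ()
⟶-++ s (P4 u v i j k ω d c) =
  subst₂ _⟶_ (sym (++-assoc₃ u (i ∷ k ∷ ω ++ [ j ]) v s)) (sym (++-assoc₃ u (i ∷ j ∷ k ∷ ω) v s))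
    (P4 u (v ++ s) i j k ω d c)

⟶*-++ : ∀ s → w ⟶* w′ → w ++ s ⟶* w′ ++ s
⟶*-++ s = gmap (_++ s) (⟶-++ s)

-- Staircases and appending a letter to them

-- A list of passes, the last one first.

word : List Word → Word
word []       = []
word (P ∷ Ps) = word Ps ++ P

-- In bubble sort, a pass that does not swap at `suc j` leaves in position `suc j` the maximum of
-- the entries up to there, and the next pass then cannot swap at `j`.
Supports : List Word → Word → Set
Supports []      P = ⊤
Supports (Q ∷ _) P = All (λ j → suc j ∈ Q) P

data Staircase : List Word → Set where
  []   : Staircase []
  step : Sorted P → Supports Ps P → Staircase Ps → Staircase (P ∷ Ps)

-- The inclusion `Q ⊆ P` keeps every letter supported by `Q` supported after the rewriting, so that
-- passes set aside during a recursion can be put back.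
data Outcome (w Q : Word) : Set where
  shrinks : w ⟶* w′ → weight w′ < weight w → Outcome w Q
  settles : Staircase (P ∷ Ps) → Q ⊆ P → w ⟶* word (P ∷ Ps) → Outcome w Q

shrinks-to : ∀ x w′ → w ≡ x → x ⟶* w′ → weight w′ < weight x → Outcome w Q
shrinks-to x w′ refl = shrinks

put-on : Outcome w Q → Sorted A → All (λ j → suc j ∈ Q) A → v ⟶* w ++ A → Outcome v A
put-on {w} {A = A} (shrinks {w′ = w′} w⟶*w′ lt) _ _ v⟶* =
  shrinks (v⟶* ◅◅ ⟶*-++ A w⟶*w′)
    (<-≤-trans (weight-mono-< {w′} {w} [] A lt) (⟶*-weight v⟶*))
put-on {A = A} (settles st Q⊆P w⟶*) sorted A⊆Q v⟶* =
  settles (step sorted (All.map Q⊆P A⊆Q) st) id (v⟶* ◅◅ ⟶*-++ A w⟶*)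

-- `D` collects the letters above `i`; with `suc i` absent, they all commute with `i`. In `gap`, `c`
-- is the largest letter below `i`, behind which `i` is to be inserted.
data Split (i : Letter) : Word → Set where
  below : All (suc i <_) D → Split i D
  gap   : ∀ C c D → All (_≤ c) C → c < i → All (suc i <_) D → Split i (C ++ c ∷ D)
  has   : ∀ C D → All (suc i <_) D → Split i (C ++ i ∷ D)

split : ∀ i {Q} → Sorted Q → suc i ∉ Q → Split i Q
split i [] _ = below []
split i {q ∷ Q} (q<Q ∷ sorted) i∉Q with <-cmp q i
... | tri≈ _ refl _ = has [] Q (All.tabulate λ x∈Q →
  ≤∧≢⇒< (All.lookup q<Q x∈Q) λ { refl → i∉Q (there x∈Q) })
... | tri> _ _ i<q = below (si<q ∷ All.map (<-trans si<q) q<Q)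
  where si<q = ≤∧≢⇒< i<q λ { refl → i∉Q (here refl) }
... | tri< q<i _ _ with split i sorted (i∉Q ∘ there)
...   | below i<Q          = gap [] q Q [] q<i i<Q
...   | gap C c D C≤c p q′ = gap (q ∷ C) c D (<⇒≤ (All.head (All.++⁻ʳ C q<Q)) ∷ C≤c) p q′
...   | has C D p          = has (q ∷ C) D p

-- With `i` both as first and as moving letter, the order condition of P4 reads `i ≤ k` or `k < i`
-- and always holds; the second `i` thus crosses `κ`, and P1 removes the pair.
cancel : ∀ u κ v → Far i κ → u ++ i ∷ κ ++ i ∷ v ⟶* u ++ κ ++ v
cancel {i} u []      v far = P1 u v i ◅ ε
cancel {i} u (k ∷ ω) v far =
  subst (_⟶ u ++ i ∷ i ∷ k ∷ ω ++ v) (cong (λ z → u ++ i ∷ k ∷ z) (++-assoc ω [ i ] v))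
    (P4 u v i i k ω (far⇒dist>1 i (k ∷ ω) far) (side (All.head far)))
  ◅ P1 u (k ∷ ω ++ v) i ◅ ε
  where
  side : Apart i k → (i ≤ i × i ≤ k) ⊎ (k < i × i ≤ i)
  side (inj₁ p) = inj₁ (≤-refl , <⇒≤ (<-trans (n<1+n i) p))
  side (inj₂ p) = inj₂ (<-trans (n<1+n k) p , ≤-refl)

weight-cancel-far : ∀ u κ v i → weight (u ++ κ ++ v) < weight (u ++ i ∷ κ ++ i ∷ v)
weight-cancel-far u κ v i = subst (weight (u ++ κ ++ v) <_)
  (weight-↭ (Perm.++⁺ˡ u (prep i (↭-sym (Perm.shift i κ v))))) (weight-cancel u (κ ++ v) i)

-- P4 with `c` as the letter that stays in front. Given `c ≤ i`, its order condition only concerns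
-- the first letter of `κ`; for empty `κ` the letter `i` is already in place.
hop : ∀ u c κ v → c ≤ i → Far i κ → (∀ {k ω} → κ ≡ k ∷ ω → i ≤ k ⊎ k < c) →
      u ++ c ∷ κ ++ i ∷ v ⟶* u ++ c ∷ i ∷ κ ++ v
hop u c []      v c≤i far side = ε
hop {i} u c (k ∷ ω) v c≤i far side =
  subst (_⟶ u ++ c ∷ i ∷ k ∷ ω ++ v) (cong (λ z → u ++ c ∷ k ∷ z) (++-assoc ω [ i ] v))
    (P4 u v c i k ω (far⇒dist>1 i (k ∷ ω) far)
      ([ (λ i≤k → inj₁ (c≤i , i≤k)) , (λ k<c → inj₂ (k<c , c≤i)) ]′ (side refl)))
  ◅ ε

regroup : (a b c d : Word) → (a ++ b ++ c) ++ d ≡ (a ++ b) ++ c ++ d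
regroup a b c d = trans (++-assoc₃ a b c d) (sym (++-assoc a b (c ++ d)))

insert-⊆ : ∀ A {a} → A ++ a ∷ B ⊆ A ++ a ∷ i ∷ B
insert-⊆ A x∈ with ∈-++⁻ A x∈
... | inj₁ p         = ∈-++⁺ˡ p
... | inj₂ (here p)  = ∈-++⁺ʳ A (here p)
... | inj₂ (there p) = ∈-++⁺ʳ A (there (there p))

sorted-insert : ∀ A {a} → Sorted (A ++ a ∷ B) → a < i → All (suc i <_) B → Sorted (A ++ a ∷ i ∷ B)
sorted-insert {i = i} A sorted a<i i<B with AllPairs-++⁻ A sorted
... | sortedA , (a<B ∷ sortedB) , A<aB =
  AllPairs.++⁺ sortedA ((a<i ∷ a<B) ∷ All.map (<-trans (n<1+n i)) i<B ∷ sortedB)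
    (All.map (λ { (p ∷ r) → p ∷ <-trans p a<i ∷ r }) A<aB)

-- If the previous pass does not support i, then i braids with suc a ≡ i, or
-- cancels, or hops left into the previous pass, where the situation recurs.

slide : ∀ A a B i → Staircase Ps → Sorted (A ++ a ∷ i ∷ B) → Supports Ps (A ++ a ∷ B) →
        Outcome (word Ps ++ A ++ a ∷ i ∷ B) (A ++ a ∷ B)
slide {[]} A a B i [] sorted sup =
  settles {P = A ++ a ∷ i ∷ B} (step sorted tt []) (insert-⊆ A) ε
slide {Q ∷ Qs} A a B i st@(step sortedQ supQ stQ) sorted sup with suc i ∈? Q
... | yes si∈Q = settles {P = A ++ a ∷ i ∷ B} (step sorted sup′ st) (insert-⊆ A) ε
  where
  sup′ : All (λ j → suc j ∈ Q) (A ++ a ∷ i ∷ B)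
  sup′ with All.++⁻ A sup
  ... | p , q ∷ r = All.++⁺ p (q ∷ si∈Q ∷ r)
... | no si∉Q with split i sortedQ si∉Q
...   | has C D i<D with AllPairs-++⁻ A sorted
...     | _ , ((a<i ∷ _) ∷ _) , A<aiB with suc a ≟ i
-- The `i` of the previous pass is `suc a`. It commutes with `D`, which lies above `suc i`, and with
-- `A`, which lies below `a`, so P2 applies to it and the factor `a ∷ suc a`.
...       | yes refl = shrinks-to ((word Qs ++ C) ++ (suc a ∷ (D ++ A) ++ a ∷ suc a ∷ []) ++ B)
              ((word Qs ++ C) ++ ((D ++ A) ++ a ∷ suc a ∷ a ∷ []) ++ B)
              (trans (regroup (word Qs) C (suc a ∷ D) _)
                (cong (λ z → (word Qs ++ C) ++ suc a ∷ z)
                  (trans (sym (++-assoc D A _)) (sym (++-assoc (D ++ A) _ B)))))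
              (P2 (word Qs ++ C) B a (D ++ A) (far⇒dist>1 (suc a) (D ++ A) far) ◅ ε)
              (weight-braid (word Qs ++ C) B a (D ++ A))
  where
  far : Far (suc a) (D ++ A)
  far = All.++⁺ (All.map inj₁ i<D) (All.map (λ p → inj₂ (s≤s (All.head p))) A<aiB)
-- Now `suc a < i`, so the two copies of `i` are separated by letters that commute with `i`.
...       | no sa≢i = shrinks-to ((word Qs ++ C) ++ i ∷ (D ++ A ++ [ a ]) ++ i ∷ B)
              ((word Qs ++ C) ++ (D ++ A ++ [ a ]) ++ B)
              (trans (regroup (word Qs) C (i ∷ D) _)
                (cong (λ z → (word Qs ++ C) ++ i ∷ z) (sym (++-assoc₃ D A [ a ] _))))
              (cancel (word Qs ++ C) (D ++ A ++ [ a ]) B far)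
              (weight-cancel-far (word Qs ++ C) (D ++ A ++ [ a ]) B i)
  where
  sa<i : suc a < i
  sa<i = ≤∧≢⇒< a<i sa≢i
  far : Far i (D ++ A ++ [ a ])
  far = All.++⁺ (All.map inj₁ i<D) (All.++⁺
    (All.map (λ p → inj₂ (<-trans (s≤s (All.head p)) sa<i)) A<aiB) (inj₂ sa<i ∷ []))
slide {Q ∷ Qs} A a B i st@(step sortedQ supQ stQ) sorted sup
    | no si∉Q | below i<Q with AllPairs-++⁻ A sorted
... | _ , ((a<i ∷ _) ∷ _) , A<aiB =
  -- `a` is supported by `suc a ≤ i`, whereas all letters of `Q` exceed `suc i`.
  contradiction (All.lookup i<Q (All.head (All.++⁻ʳ A sup))) (≤⇒≯ (m≤n⇒m≤1+n a<i))
slide {_ ∷ Qs} A a B i st@(step sortedQ supQ stQ) sorted sup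
    | no si∉Q | gap C c D C≤c c<i i<D with AllPairs-++⁻ A sorted
... | sortedA , ((a<i ∷ a<B) ∷ (_ ∷ sortedB)) , A<aiB =
  -- `i` hops over `D ++ A ++ [ a ]` to just behind `c`, which plays the role of `a` one pass
  -- earlier; the pass without `i` is put back afterwards.
  put-on (slide C c D i stQ (sorted-insert C sortedQ c<i i<D) supQ) sortedE sup
    (subst₂ _⟶*_ (sym eq₁) (sym eq₂) (hop (word Qs ++ C) c (D ++ A ++ [ a ]) B (<⇒≤ c<i) far (side D i<D)))
  where
  sortedE : Sorted (A ++ a ∷ B)
  sortedE = AllPairs.++⁺ sortedA (a<B ∷ sortedB)
    (All.map (λ { (p ∷ q ∷ r) → p ∷ r }) A<aiB)
  -- A support at most `i` cannot lie in `D`, so it is at most `c`. Hence `A ++ [ a ]` lies below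
  -- `c`, which gives its commutation with `i` and, when `D` is empty, the order condition of P4.
  suc-≤c : ∀ {x} → x < i → suc x ∈ C ++ c ∷ D → suc x ≤ c
  suc-≤c x<i x∈ with ∈-++⁻ C x∈
  ... | inj₁ p            = All.lookup C≤c p
  ... | inj₂ (here refl)  = ≤-refl
  ... | inj₂ (there p)    = contradiction (All.lookup i<D p) (≤⇒≯ (m≤n⇒m≤1+n x<i))
  A∪a<c : All (_< c) (A ++ [ a ])
  A∪a<c with All.++⁻ A sup
  ... | p , q ∷ _ = All.++⁺
    (All.zipWith (λ { (p ∷ _ , q) → suc-≤c (<-trans p a<i) q }) (A<aiB , p)) (suc-≤c a<i q ∷ [])
  far : Far i (D ++ A ++ [ a ])
  far = All.++⁺ (All.map inj₁ i<D) (All.map (λ p → inj₂ (≤-<-trans p c<i)) A∪a<c)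
  side : ∀ D → All (suc i <_) D → ∀ {k ω} → D ++ A ++ [ a ] ≡ k ∷ ω → i ≤ k ⊎ k < c
  side []      _       eq with subst (All (_< c)) eq A∪a<c
  ... | p ∷ _ = inj₂ p
  side (d ∷ D) (p ∷ _) refl = inj₁ (<⇒≤ (<-trans (n<1+n i) p))
  eq₁ : (word Qs ++ C ++ c ∷ D) ++ A ++ a ∷ i ∷ B ≡
        (word Qs ++ C) ++ c ∷ (D ++ A ++ [ a ]) ++ i ∷ B
  eq₁ = trans (regroup (word Qs) C (c ∷ D) _)
    (cong (λ z → (word Qs ++ C) ++ c ∷ z) (sym (++-assoc₃ D A [ a ] _)))
  eq₂ : (word Qs ++ C ++ c ∷ i ∷ D) ++ A ++ a ∷ B ≡
        (word Qs ++ C) ++ c ∷ i ∷ (D ++ A ++ [ a ]) ++ B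
  eq₂ = trans (regroup (word Qs) C (c ∷ i ∷ D) _)
    (cong (λ z → (word Qs ++ C) ++ c ∷ i ∷ z) (sym (++-assoc₃ D A [ a ] _)))

≤-last : ∀ xs {z} → Sorted (xs ++ [ z ]) → x ∈ xs ++ [ z ] → x ≤ z
≤-last xs sorted x∈ with ∈-++⁻ xs x∈ | AllPairs-++⁻ xs sorted
... | inj₂ (here refl) | _         = ≤-refl
... | inj₁ p           | _ , _ , q = <⇒≤ (All.head (All.lookup q p))

-- `suc d` occurs in the pass before `D`, and `z`, the last letter of that pass, is at least
-- `suc d`.
<-last : ∀ {d z} → Staircase (D ∷ Qs) → d ∈ D → word Qs ≡ w ++ [ z ] → d < z
<-last {Qs = []}     {w = []}    (step _ _ _) d∈D ()
<-last {Qs = []}     {w = _ ∷ _} (step _ _ _) d∈D ()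
<-last {Qs = Q ∷ Qs} {w} (step _ sup (step sorted _ _)) d∈D eq with initLast Q
... | []      = contradiction (All.lookup sup d∈D) λ ()
... | Q′ ∷ʳ′ q with ∷ʳ-injective (word Qs ++ Q′) w (trans (++-assoc (word Qs) Q′ [ q ]) eq)
...   | _ , refl = ≤-last Q′ sorted (All.lookup sup d∈D)

-- A nonempty `D` is a maximal increasing factor, so P3 applies: the letter before it, if any,
-- exceeds the head of `D` by `<-last`, and the letter `i` after it is smaller than all of `D`.
step-over : Staircase (D ∷ Qs) → All (suc i <_) D →
            word (D ∷ Qs) ++ i ∷ N ⟶* (word Qs ++ i ∷ D) ++ N
step-over {[]} {Qs} {i} {N} _ _ = subst₂ _⟶*_
  (cong (_++ i ∷ N) (sym (++-identityʳ (word Qs)))) (sym (++-assoc (word Qs) [ i ] N)) ε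
step-over {D@(d ∷ D′)} {Qs} {i} {N} st@(step sorted _ _) i<D@(i<d ∷ _) = subst₂ _⟶_
  (trans (cong (word Qs ++_) (++-assoc D [ i ] N)) (sym (++-assoc (word Qs) D (i ∷ N))))
  (sym (++-assoc (word Qs) (i ∷ D) N))
  (P3 (word Qs) N i D (far⇒dist>1 i D (All.map inj₁ i<D)) record
    { nonempty   = λ ()
    ; increasing = sorted⇒increasing sorted
    ; maximal    = λ u′ x y v′ eq eq′ inc → maximalˡ u′ x eq inc , maximalʳ x y v′ eq′ inc
    })
  ◅ ε
  where
  maximalˡ : ∀ u′ x {y} → word Qs ≡ u′ ++ x → Increasing (x ++ D ++ y) → x ≡ []
  maximalˡ u′ x eq inc with initLast x
  ... | []      = refl
  ... | x′ ∷ʳ′ z with AllPairs-++⁻ (x′ ++ [ z ]) (increasing⇒sorted inc)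
  ...   | _ , _ , x<D = contradiction (All.head (All.head (All.++⁻ʳ x′ x<D)))
    (<-asym (<-last {w = u′ ++ x′} st (here refl) (trans eq (sym (++-assoc u′ x′ [ z ])))))
  maximalʳ : ∀ x y v′ → i ∷ N ≡ y ++ v′ → Increasing (x ++ D ++ y) → y ≡ []
  maximalʳ x []      v′ eq   inc = refl
  maximalʳ x (_ ∷ y) v′ refl inc with AllPairs-++⁻ x (increasing⇒sorted inc)
  ... | _ , p , _ with AllPairs-++⁻ D p
  ...   | _ , _ , (d<i ∷ _) ∷ _ = contradiction d<i (<-asym (<-trans (n<1+n i) i<d))

-- The counterpart of `slide` for a letter `i` that opens a pass. `N` is the rest of this pass,
-- empty at first; once `i` has crossed a whole pass `L`, that pass becomes the new `N`.
insert : ∀ i → Staircase Ps → Sorted N → Supports Ps N → All (suc i <_) N →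
         Outcome (word Ps ++ i ∷ N) N
insert {N = N} i [] sortedN _ i<N =
  settles (step (All.map (<-trans (n<1+n i)) i<N ∷ sortedN) tt []) there ε
insert {L ∷ Qs} {N} i st@(step sortedL supL stQ) sortedN supN i<N with suc i ∈? L
... | yes si∈L =
  settles (step (All.map (<-trans (n<1+n i)) i<N ∷ sortedN) (si∈L ∷ supN) st) there ε
... | no si∉L with split i sortedL si∉L
...   | below i<D = put-on (insert i stQ sortedL supL i<D) sortedN supN (step-over st i<D)
...   | has C D i<D = shrinks-to ((word Qs ++ C) ++ i ∷ D ++ i ∷ N) ((word Qs ++ C) ++ D ++ N)
          (regroup (word Qs) C (i ∷ D) _)
          (cancel (word Qs ++ C) D N (All.map inj₁ i<D))
          (weight-cancel-far (word Qs ++ C) D N i)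
...   | gap C c D C≤c c<i i<D =
  put-on (slide C c D i stQ (sorted-insert C sortedL c<i i<D) supL) sortedN supN
    (subst₂ _⟶*_ (sym (regroup (word Qs) C (c ∷ D) _)) (sym (regroup (word Qs) C (c ∷ i ∷ D) _))
      (hop (word Qs ++ C) c D N (<⇒≤ c<i) (All.map inj₁ i<D) side))
  where
  side : ∀ {k ω} → D ≡ k ∷ ω → i ≤ k ⊎ k < c
  side refl = inj₁ (<⇒≤ (<-trans (n<1+n i) (All.head i<D)))

-- Every word rewrites to a staircase

StaircaseForm : Word → Set
StaircaseForm w = ∃[ Ps ] Staircase Ps × w ⟶* word Ps

-- Letters of `v` are appended one at a time. While they settle, the recursion is structural in `v`,
-- and `rec` stays available because weights never grow; a letter that shrinks the weight hands the
-- whole remaining word to `rec`.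
absorb : ∀ Ps v → Staircase Ps →
         (∀ {w} → weight w < weight (word Ps ++ v) → StaircaseForm w) → StaircaseForm (word Ps ++ v)
absorb Ps []      st rec = Ps , st , subst (_⟶* word Ps) (sym (++-identityʳ _)) ε
absorb Ps (i ∷ v) st rec
  with insert i st [] (supports-[] Ps) [] | sym (++-assoc (word Ps) [ i ] v)
  where
  supports-[] : ∀ Ps → Supports Ps []
  supports-[] []      = tt
  supports-[] (_ ∷ _) = []
... | shrinks {w′ = w′} t lt | eq
    with rec (subst (weight (w′ ++ v) <_) (cong weight (sym eq))
           (weight-mono-< {w′} {word Ps ++ [ i ]} [] v lt))
...   | Qs , st′ , t′ = Qs , st′ , subst (_⟶* word Qs) (sym eq) (⟶*-++ v t ◅◅ t′)
absorb Ps (i ∷ v) st rec | settles {P} {Qs} st′ _ t | eq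
    with absorb (P ∷ Qs) v st′ (λ lt → rec (<-≤-trans lt
           (subst (weight (word (P ∷ Qs) ++ v) ≤_) (cong weight (sym eq)) (⟶*-weight (⟶*-++ v t)))))
...   | Rs , st″ , t′ = Rs , st″ , subst (_⟶* word Rs) (sym eq) (⟶*-++ v t ◅◅ t′)

staircaseForm : ∀ w → StaircaseForm w
staircaseForm w = go w (<-wellFounded _)
  where
  go : ∀ w → Acc _<_ (weight w) → StaircaseForm w
  go w (acc rs) = absorb [] w [] (λ lt → go _ (rs lt))

-- Inverse action of a word

-- The inverse of `⟦ w ⟧`. If `f` gives the entries of a list, `f ∘ inv w` gives them after the
-- entry in each position `x` has moved to `⟦ w ⟧ x`.
inv : Word → ℕ → ℕ
inv []      x = x
inv (i ∷ w) x = inv w (transposition i x)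

inv-⟦⟧ : ∀ w x → inv w (⟦ w ⟧ x) ≡ x
inv-⟦⟧ []      x = refl
inv-⟦⟧ (i ∷ w) x = trans (cong (inv w) (transposition-involutive i _)) (inv-⟦⟧ w x)

inv-++ : ∀ w w′ x → inv (w ++ w′) x ≡ inv w′ (inv w x)
inv-++ []      w′ x = refl
inv-++ (i ∷ w) w′ x = inv-++ w w′ (transposition i x)

inv-≤ : m ∉ S → x ≤ m → inv S x ≤ m
inv-≤ {S = []}    m∉S p = p
inv-≤ {S = s ∷ S} m∉S p =
  inv-≤ (m∉S ∘ there) (transposition-≤ s _ _ (λ { refl → m∉S (here refl) }) p)

inv-> : m ∉ S → m < x → m < inv S x
inv-> {S = []}    m∉S p = p
inv-> {S = s ∷ S} m∉S p =
  inv-> (m∉S ∘ there) (transposition-> s _ _ (λ { refl → m∉S (here refl) }) p)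

inv-below : All (x <_) S → inv S x ≡ x
inv-below []                        = refl
inv-below {x} {s ∷ S} (p ∷ ps) =
  trans (cong (inv S) (transposition-below s x p)) (inv-below ps)

all<⇒∉ : All (x <_) S → x ∉ S
all<⇒∉ p x∈S = <-irrefl refl (All.lookup p x∈S)

-- `inv S` carries `suc m` up along the consecutive letters `suc m`, `suc (suc m)`, ... of `S` and
-- stops at the first position that is not in `S`.
inv-∉ : Sorted S → m ∉ S → inv S (suc m) ∉ S
inv-∉ {s ∷ S} {m} (s<S ∷ sorted) m∉S with <-cmp s (suc m)
... | tri≈ _ refl _ rewrite transposition-left (suc m) = λ
  { (here eq) → <-irrefl (sym eq) (inv-> (all<⇒∉ s<S) ≤-refl)
  ; (there p) → inv-∉ sorted (all<⇒∉ s<S) p }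
... | tri> _ _ sm<s rewrite transposition-below s (suc m) sm<s
                          | inv-below (All.map (<-trans sm<s) s<S) = λ
  { (here eq) → <-irrefl eq sm<s
  ; (there p) → <-asym sm<s (All.lookup s<S p) }
... | tri< s<sm _ _ rewrite transposition-above s (suc m)
                              (s≤s (≤∧≢⇒< (s≤s⁻¹ s<sm) λ { refl → m∉S (here refl) })) = λ
  { (here eq) → <-irrefl (sym eq) (≤-<-trans (s≤s⁻¹ s<sm) (inv-> (m∉S ∘ there) ≤-refl))
  ; (there p) → inv-∉ sorted (m∉S ∘ there) p }

-- Bubble sort undoes the passes of a staircase

values : (ℕ → ℕ) → ℕ → ℕ → List ℕ
values f p zero    = []
values f p (suc k) = f p ∷ values f (suc p) k

values-cong : ∀ {f g} p k → (∀ x → p ≤ x → f x ≡ g x) → values f p k ≡ values g p k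
values-cong p zero    eq = refl
values-cong p (suc k) eq =
  cong₂ _∷_ (eq p ≤-refl) (values-cong (suc p) k λ x p<x → eq x (<⇒≤ p<x))

tabulate-values : ∀ p (h : Fin n → ℕ) → (∀ j → h j ≡ g (p + toℕ j)) → tabulate h ≡ values g p n
tabulate-values {zero}      p h eq = refl
tabulate-values {suc n} {g} p h eq = cong₂ _∷_
  (trans (eq fzero) (cong g (+-identityʳ p)))
  (tabulate-values (suc p) (h ∘ fsuc) λ j → trans (eq (fsuc j)) (cong g (+-suc p (toℕ j))))

bubblePass-swap : ∀ p {x y} ys {ω zs} → y < x → bubblePass (suc p) x ys ≡ (ω , zs) →
                  bubblePass p x (y ∷ ys) ≡ (p ∷ ω , y ∷ zs)
bubblePass-swap p {x} {y} ys y<x eq rewrite dec-true (y <? x) y<x | eq = refl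

bubblePass-keep : ∀ p {x y} ys {ω zs} → x < y → bubblePass (suc p) y ys ≡ (ω , zs) →
                  bubblePass p x (y ∷ ys) ≡ (ω , x ∷ zs)
bubblePass-keep p {x} {y} ys x<y eq rewrite dec-false (y <? x) (<-asym x<y) | eq = refl

-- A pass over f ∘ inv S swaps exactly at S, and leaves f, as soon as every
-- position outside S holds a left-to-right maximum of f.

bubblePass-values :
  ∀ k p S → p + k ≡ m → Sorted S → All (p ≤_) S → All (_< m) S →
  (∀ {i j} → p ≤ i → i < j → j ≤ m → j ∉ S → f i < f j) →
  bubblePass p (f (inv S p)) (values (f ∘ inv S) (suc p) k) ≡ (S , values f p (suc k))
bubblePass-values zero p [] eq _ _ _ _ = refl
bubblePass-values zero p (s ∷ S) eq _ (p≤s ∷ _) (s<m ∷ _) _ =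
  contradiction (subst (s <_) (trans (sym eq) (+-identityʳ p)) s<m) (≤⇒≯ p≤s)
bubblePass-values {m} {f} (suc k) p S eq sorted p≤S S<m max = cases S sorted p≤S S<m max
  where
  eq′ : suc p + k ≡ m
  eq′ = trans (sym (+-suc p k)) eq
  p<m : p < m
  p<m = subst (suc p ≤_) eq′ (m≤m+n (suc p) k)
  keep : ∀ S → Sorted S → All (p <_) S → All (_< m) S →
         (∀ {i j} → p ≤ i → i < j → j ≤ m → j ∉ S → f i < f j) →
         bubblePass p (f (inv S p)) (values (f ∘ inv S) (suc p) (suc k)) ≡ (S , values f p (suc (suc k)))
  -- The entry in position `suc p` comes from `inv S (suc p)`, which is outside `S` by `inv-∉` and
  -- so holds a left-to-right maximum exceeding `f p`: no swap.
  keep S sorted p<S S<m max rewrite inv-below p<S =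
    bubblePass-keep p (values (f ∘ inv S) (suc (suc p)) k)
      (max ≤-refl (inv-> p∉S ≤-refl)
        (inv-≤ (λ m∈S → <-irrefl refl (All.lookup S<m m∈S)) p<m) (inv-∉ sorted p∉S))
      (bubblePass-values k (suc p) S eq′ sorted p<S S<m λ p<i → max (<⇒≤ p<i))
    where
    p∉S : p ∉ S
    p∉S = all<⇒∉ p<S
  cases : ∀ S → Sorted S → All (p ≤_) S → All (_< m) S →
         (∀ {i j} → p ≤ i → i < j → j ≤ m → j ∉ S → f i < f j) →
         bubblePass p (f (inv S p)) (values (f ∘ inv S) (suc p) (suc k)) ≡ (S , values f p (suc (suc k)))
  cases []      sorted p≤S S<m max = keep [] sorted [] S<m max
  cases (s ∷ S) sorted@(s<S ∷ sorted′) (p≤s ∷ _) S<m@(_ ∷ S<m′) max with p ≟ s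
  ... | no p≢s = keep (s ∷ S) sorted (p<s ∷ All.map (<-trans p<s) s<S) S<m max
    where p<s = ≤∧≢⇒< p≤s p≢s
  -- Here the same two entries stand in the opposite order: the maximum is carried, `f p` comes
  -- next, and they are swapped.
  ... | yes refl
    rewrite transposition-left p | transposition-right p | inv-below s<S
          | values-cong {f ∘ inv S ∘ transposition p} {f ∘ inv S} (suc (suc p)) k
              (λ x p<x → cong (f ∘ inv S) (transposition-above p x p<x)) =
    bubblePass-swap p (values (f ∘ inv S) (suc (suc p)) k)
      (max ≤-refl (inv-> p∉S ≤-refl)
        (inv-≤ (λ m∈S → <-irrefl refl (All.lookup S<m′ m∈S)) p<m)
        λ { (here e) → <-irrefl (sym e) (inv-> p∉S ≤-refl) ; (there e) → inv-∉ sorted′ p∉S e })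
      (bubblePass-values k (suc p) S eq′ sorted′ s<S S<m′ λ p<i i<j j≤m j∉S →
        max (<⇒≤ p<i) i<j j≤m λ { (here refl) → <-asym p<i i<j ; (there e) → j∉S e })
    where
    p∉S : p ∉ S
    p∉S = all<⇒∉ s<S

MaximaOutside : ℕ → (ℕ → ℕ) → Word → Set
MaximaOutside n f S = ∀ {i j} → i < j → j < n → j ∉ S → f i < f j

-- If `suc j ∉ Q`, then `j ∉ S` by support. So no letter of `S` crosses the cut between `j` and
-- `suc j`: `inv S` keeps `i` and `suc j` in order, and sends `suc j` outside `S`.
maximaOutside-inv : Sorted S → All (λ s → suc s < n) S → All (λ s → suc s ∈ Q) S →
                    MaximaOutside n f S → MaximaOutside n (f ∘ inv S) Q
maximaOutside-inv {S} sorted S<n S⊆Q max {i} {suc j} (s≤s i≤j) (s≤s {n = m} j<m) j∉Q =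
  max (≤-<-trans (inv-≤ j∉S i≤j) (inv-> j∉S ≤-refl)) (s≤s (inv-≤ m∉S j<m)) (inv-∉ sorted j∉S)
  where
  j∉S : j ∉ S
  j∉S j∈S = j∉Q (All.lookup S⊆Q j∈S)
  m∉S : m ∉ S
  m∉S m∈S = <-irrefl refl (All.lookup S<n m∈S)

pass-values : ∀ n → Sorted S → All (λ s → suc s < n) S → MaximaOutside n f S →
              pass (values (f ∘ inv S) 0 n) ≡ (S , values f 0 n)
pass-values {[]}    zero    _      _         _   = refl
pass-values {s ∷ S} zero    _      (() ∷ _)  _
pass-values {S}     (suc n) sorted S<n       max =
  bubblePass-values n 0 S refl sorted (All.tabulate λ _ → z≤n) (All.map s≤s⁻¹ S<n)
    λ _ i<j j≤n → max i<j (s≤s j≤n)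

iterate′ : ∀ {xs ys} → pass xs ≡ (P , ys) → P ≢ [] → BubbleSort ys ρ → BubbleSort xs (P ++ ρ)
iterate′ {ρ = ρ} {xs} eq P≢[] bs = subst (λ r → BubbleSort xs (proj₁ r ++ ρ)) eq
  (iterate (P≢[] ∘ trans (sym (cong proj₁ eq))) (subst (λ r → BubbleSort (proj₂ r) ρ) (sym eq) bs))

MaximaOutsideTop : ℕ → (ℕ → ℕ) → List Word → Set
MaximaOutsideTop n f []      = ⊤
MaximaOutsideTop n f (P ∷ _) = MaximaOutside n f P

-- Passes are undone from the last to the first. `ρ` is what bubble sort does from `f` on, and each
-- undone pass is put in front of it.
bubbleSort-word : ∀ n → Staircase Ps → All (λ s → suc s < n) (word Ps) → MaximaOutsideTop n f Ps →
                  BubbleSort (values f 0 n) ρ → BubbleSort (values (f ∘ inv (word Ps)) 0 n) (word Ps ++ ρ)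
bubbleSort-word n [] _ _ bs = bs
bubbleSort-word {P ∷ Ps} {f} {ρ} n (step sorted sup st) Ps<n max bs =
  subst₂ BubbleSort
    (values-cong 0 n λ x _ → cong f (sym (inv-++ (word Ps) P x)))
    (sym (++-assoc (word Ps) P ρ))
    (bubbleSort-word n st (All.++⁻ˡ (word Ps) Ps<n) (next st sup) (onePass P sorted P<n max))
  where
  P<n : All (λ s → suc s < n) P
  P<n = All.++⁻ʳ (word Ps) Ps<n
  next : Staircase Qs → Supports Qs P → MaximaOutsideTop n (f ∘ inv P) Qs
  next {[]}     _ _   = tt
  next {Q ∷ Qs} _ sup = maximaOutside-inv sorted P<n sup max
  onePass : ∀ P → Sorted P → All (λ s → suc s < n) P → MaximaOutside n f P →
            BubbleSort (values (f ∘ inv P) 0 n) (P ++ ρ)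
  -- Staircases may contain empty passes, which are no iterations of bubble sort.
  onePass []        _      _   _   = bs
  onePass P@(_ ∷ _) sorted P<n max = iterate′ (pass-values n sorted P<n max) (λ ()) bs

bubbleSort-deterministic : ∀ {xs} → BubbleSort xs w → BubbleSort xs w′ → w ≡ w′
bubbleSort-deterministic (stop _)       (stop _)       = refl
bubbleSort-deterministic (stop p)       (iterate ¬p _) = contradiction p ¬p
bubbleSort-deterministic (iterate ¬p _) (stop p)       = contradiction p ¬p
bubbleSort-deterministic (iterate _ p)  (iterate _ q)  = cong (_ ++_) (bubbleSort-deterministic p q)

-- Bounding the letters of a staircase

-- A largest letter that occurs only once cannot be cancelled, so the permutation detects it.
data LargestLetter : Word → Set where
  empty   : LargestLetter []
  largest : ∀ u m v → All (_< m) u → All (_< m) v → LargestLetter (u ++ m ∷ v)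

-- A nonempty first pass ends with its largest letter; every letter `j` of a later pass is smaller,
-- since `suc j` occurs in the pass before.
word-largestLetter : Staircase Ps → LargestLetter (word Ps)
word-largestLetter [] = empty
word-largestLetter {P ∷ []} (step sorted _ _) with initLast P
... | []      = empty
... | A ∷ʳ′ m = largest A m [] (All.map All.head (proj₂ (proj₂ (AllPairs-++⁻ A sorted)))) []
word-largestLetter {P ∷ Q ∷ Qs} (step sorted sup st) with word Qs ++ Q in eq | word-largestLetter st
... | _ | empty with ++-conicalʳ (word Qs) Q eq
word-largestLetter {[] ∷ Q ∷ Qs} (step sorted sup st) | _ | empty | refl = empty
word-largestLetter {_ ∷ _} (step _ (() ∷ _) _) | _ | empty | refl
word-largestLetter {P ∷ Q ∷ Qs} (step sorted sup st) | _ | largest u m v u<m v<m =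
  subst LargestLetter (sym (++-assoc u (m ∷ v) P)) (largest u m (v ++ P) u<m (All.++⁺ v<m P<m))
  where
  ≤m : x ∈ u ++ m ∷ v → x ≤ m
  ≤m x∈ with ∈-++⁻ u x∈
  ... | inj₁ p           = <⇒≤ (All.lookup u<m p)
  ... | inj₂ (here refl) = ≤-refl
  ... | inj₂ (there p)   = <⇒≤ (All.lookup v<m p)
  P<m : All (_< m) P
  P<m = All.map (λ sj∈Q → ≤m (subst (_ ∈_) eq (∈-++⁺ʳ (word Qs) sj∈Q))) sup

⟦⟧-above : All (_< m) w → ⟦ w ⟧ (suc m) ≡ suc m
⟦⟧-above                     []       = refl
⟦⟧-above {m} {w = i ∷ w} (p ∷ ps) =
  trans (cong (transposition i) (⟦⟧-above ps)) (transposition-above i (suc m) (s≤s p))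

⟦⟧-≤ : All (_< m) w → x ≤ m → ⟦ w ⟧ x ≤ m
⟦⟧-≤ []       x≤m = x≤m
⟦⟧-≤ (p ∷ ps) x≤m = transposition-≤ _ _ _ (<⇒≢ p) (⟦⟧-≤ ps x≤m)

-- `v` fixes `suc m`, the letter `m` takes it to `m`, and `u` keeps it at most `m`. As `suc m` is
-- moved, it is less than `n`.
letters-bounded : LargestLetter w → (∀ m → n ≤ m → ⟦ w ⟧ m ≡ m) → All (λ s → suc s < n) w
letters-bounded         empty                   fixes = []
letters-bounded {n = n} (largest u m v u<m v<m) fixes =
  All.++⁺ (All.map suc<n u<m) (sm<n ∷ All.map suc<n v<m)
  where
  moved : ⟦ u ++ m ∷ v ⟧ (suc m) ≤ m
  moved = subst (_≤ m) (sym (trans (⟦++⟧ u (m ∷ v) (suc m)) (cong ⟦ u ⟧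
    (trans (cong (transposition m) (⟦⟧-above v<m)) (transposition-right m))))) (⟦⟧-≤ u<m ≤-refl)
  sm<n : suc m < n
  sm<n = ≰⇒> λ n≤sm → <-irrefl refl (subst (_≤ m) (fixes (suc m) n≤sm) moved)
  suc<n : x < m → suc x < n
  suc<n x<m = <-trans (s≤s x<m) sm<n

-- Uniqueness of the staircase of a permutation

-- Undoing the passes starts from the sorted list, `f = suc`, where every entry is a left-to-right
-- maximum, and ends at the list of `σ`.
staircase⇒bubblian : (σ : Permutation′ n) → Staircase Ps → word Ps IsDecompositionOf σ →
                     word Ps IsBubblianDecompositionOf σ
staircase⇒bubblian {n} {Ps} σ st (acts , fixes) = subst₂ BubbleSort
  (sym (tabulate-values 0 _ λ j → cong suc (sym (inv-acts j)))) (++-identityʳ _)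
  (bubbleSort-word n st (letters-bounded (word-largestLetter st) fixes) (initial Ps)
    (stop (cong proj₁ (pass-values n [] [] λ i<j _ _ → s<s i<j))))
  where
  initial : ∀ Qs → MaximaOutsideTop n suc Qs
  initial []      = tt
  initial (_ ∷ _) = λ i<j _ _ → s<s i<j
  inv-acts : ∀ j → inv (word Ps) (toℕ j) ≡ toℕ (σ ⟨$⟩ˡ j)
  inv-acts j = trans
    (cong (inv (word Ps)) (sym (trans (acts (σ ⟨$⟩ˡ j)) (cong toℕ (inverseʳ σ)))))
    (inv-⟦⟧ (word Ps) _)

⟶*-decomposition : (σ : Permutation′ n) → w ⟶* w′ → w IsDecompositionOf σ → w′ IsDecompositionOf σ
⟶*-decomposition σ w⟶* (acts , fixes) =
  (λ x → trans (sym (⟶*-sound w⟶* (toℕ x))) (acts x)) ,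
  λ m n≤m → trans (sym (⟶*-sound w⟶* m)) (fixes m n≤m)

-- The staircase reached from `w` and `word Ps` both record the swaps of bubble sort on the list of
-- `σ`, hence are the same word.
staircase-reach : (σ : Permutation′ n) → Staircase Ps → word Ps IsDecompositionOf σ →
                  w IsDecompositionOf σ → w ⟶* word Ps
staircase-reach {Ps = Ps} {w} σ st dec decw with staircaseForm w
... | Qs , stQ , w⟶* = subst (w ⟶*_)
  (bubbleSort-deterministic
    (staircase⇒bubblian σ stQ (⟶*-decomposition σ w⟶* decw))
    (staircase⇒bubblian σ st dec))
  w⟶*

-- Staircases are normal forms

splitAt-++ : ∀ {X : Set} (a : List X) {b} x {j v} → a ++ b ≡ x ++ j ∷ v →
           (∃[ v′ ] a ≡ x ++ j ∷ v′ × v ≡ v′ ++ b) ⊎ (∃[ c ] b ≡ c ++ j ∷ v × x ≡ a ++ c)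
splitAt-++ []      x       eq = inj₂ (x , eq , refl)
splitAt-++ (y ∷ a) []      eq with refl , eq′ ← ∷-injective eq = inj₁ (a , refl , sym eq′)
splitAt-++ (y ∷ a) (z ∷ x) eq with ∷-injective eq
... | refl , eq′ with splitAt-++ a x eq′
...   | inj₁ (v′ , p , q) = inj₁ (v′ , cong (y ∷_) p , q)
...   | inj₂ (c , p , q)  = inj₂ (c , p , cong (y ∷_) q)

-- Supports only look back to earlier passes, so a staircase may be cut after any letter. The letter
-- moved by P3 or P4 can thus be taken as the last one of the last pass.
staircase-prefix : ∀ x → Staircase Ps → word Ps ≡ x ++ j ∷ v →
                   ∃[ P ] ∃[ Qs ] Staircase ((P ++ [ j ]) ∷ Qs) × x ≡ word Qs ++ P
staircase-prefix []      [] ()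
staircase-prefix (_ ∷ _) [] ()
staircase-prefix {P ∷ Ps} {j} {v} x (step sorted sup st) eq with splitAt-++ (word Ps) x eq
... | inj₁ (_ , eq′ , _)  = staircase-prefix x st eq′
... | inj₂ (c , refl , p) with AllPairs-++⁻ c sorted
...   | sortedC , _ , C<j = c , Ps ,
  step (AllPairs.++⁺ sortedC ([] ∷ []) (All.map (λ q → All.head q ∷ []) C<j)) (supports-prefix sup) st , p
  where
  supports-prefix : Supports Qs (c ++ j ∷ v) → Supports Qs (c ++ [ j ])
  supports-prefix {[]}    _   = tt
  supports-prefix {_ ∷ _} sup = All.++⁺ (All.++⁻ˡ c sup) (All.head (All.++⁻ʳ c sup) ∷ [])

-- `ω` is never maximal: it extends to the right by `i` if `i` has a predecessor in its pass, and
-- otherwise to the left by a run starting with the support `suc i`.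
¬P3 : ∀ u v i ω → Staircase Ps → word Ps ≡ (u ++ ω) ++ i ∷ v →
      Far i ω → ¬ MaximallyIncreasing u ω (i ∷ v)
¬P3 u v i ω st eq far max with staircase-prefix (u ++ ω) st eq
... | P , Qs , st′ , eq′ with initLast ω
...   | [] = MaximallyIncreasing.nonempty max refl
...   | ω′ ∷ʳ′ l with initLast P
...     | P′ ∷ʳ′ p with st′ | ∷ʳ-injective (u ++ ω′) (word Qs ++ P′)
              (trans (++-assoc u ω′ [ l ]) (trans eq′ (sym (++-assoc (word Qs) P′ [ p ]))))
...       | step sorted _ _ | _ , refl =
  contradiction
    (proj₂ (maximal u [] [ i ] v (sym (++-identityʳ u)) refl
      (sorted⇒increasing (AllPairs.++⁺ sortedω ([] ∷ [])
        (All.tabulate λ x∈ → ≤-<-trans (≤-last ω′ sortedω x∈) p<i ∷ [])))))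
    λ ()
  where
  open MaximallyIncreasing max
  sortedω : Sorted (ω′ ++ [ p ])
  sortedω = increasing⇒sorted increasing
  p<i : p < i
  p<i = All.head (All.head (All.++⁻ʳ P′ (proj₂ (proj₂ (AllPairs-++⁻ (P′ ++ [ p ]) sorted)))))
¬P3 u v i ω st eq far max | P , [] , st′ , eq′ | ω′ ∷ʳ′ l | [] =
  contradiction (++-conicalʳ ω′ [ l ] (++-conicalʳ u (ω′ ++ [ l ]) eq′)) λ ()
¬P3 u v i ω st eq far max | P , Q ∷ Qs , step _ (si∈Q ∷ _) (step sorted _ _) , eq′ | ω′ ∷ʳ′ l | []
  with ∈-∃++ si∈Q
... | C , D , refl with splitAt-++ u (word Qs ++ C)
        (trans eq′ (trans (++-identityʳ _) (sym (++-assoc (word Qs) C (suc i ∷ D)))))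
...   | inj₂ (c , eq″ , _) = suc∈⇒¬far (subst (suc i ∈_) (sym eq″) (∈-++⁺ʳ c (here refl))) far
-- `suc i ∷ z ++ ω` is the end of the previous pass, hence increasing.
...   | inj₁ (z , p , refl) = contradiction
  (proj₁ (MaximallyIncreasing.maximal max (word Qs ++ C) (suc i ∷ z) [] (i ∷ v) p refl
    (sorted⇒increasing (subst (λ ω → Sorted (suc i ∷ z ++ ω)) (sym (++-identityʳ _))
      (proj₁ (proj₂ (AllPairs-++⁻ C sorted)))))))
  λ ()

-- The support `suc j` cannot lie in `k ∷ ω`, which is far from `j`. If it is `i` or precedes `i`
-- within a pass, then `j < i`; otherwise `i`, `k`, `j` ascend within one pass. Either way the order
-- condition of P4 fails.
P4-order : ∀ u i k ω → Staircase Ps → word Ps ≡ (u ++ i ∷ k ∷ ω) ++ j ∷ v → Far j (k ∷ ω) →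
           j < i ⊎ (i < k × k < j)
P4-order {j = j} u i k ω st eq far with staircase-prefix (u ++ i ∷ k ∷ ω) st eq
... | P , Qs , st′ , eq′ = compare Qs st′ eq′
  where
  ascending : ∀ u → P ≡ u ++ i ∷ k ∷ ω → Sorted (P ++ [ j ]) → i < k × k < j
  ascending u refl sorted with AllPairs-++⁻ P sorted
  ... | sortedP , _ , P<j with AllPairs-++⁻ u sortedP
  ...   | _ , ((i<k ∷ _) ∷ _) , _ = i<k , All.head (All.head (All.tail (All.++⁻ʳ u P<j)))
  compare : ∀ Qs → Staircase ((P ++ [ j ]) ∷ Qs) → u ++ i ∷ k ∷ ω ≡ word Qs ++ P →
            j < i ⊎ (i < k × k < j)
  compare []       (step sorted _ _) eq = inj₂ (ascending u (sym eq) sorted)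
  compare (Q ∷ Qs) (step sorted sup (step sortedQ _ _)) eq with ∈-∃++ (All.head (All.++⁻ʳ P sup))
  ... | C , D , refl with splitAt-++ (u ++ [ i ]) (word Qs ++ C)
          (trans (++-assoc u [ i ] (k ∷ ω)) (trans eq (regroup (word Qs) C (suc j ∷ D) P)))
  ...   | inj₂ (c , p , _) = contradiction far (suc∈⇒¬far (subst (suc j ∈_) (sym p) (∈-++⁺ʳ c (here refl))))
  ...   | inj₁ (z , p , q) with initLast z
  ...     | [] with ∷ʳ-injective u (word Qs ++ C) p
  ...       | _ , refl = inj₁ ≤-refl
  compare (Q ∷ Qs) (step sorted sup (step sortedQ _ _)) eq | C , D , refl | inj₁ (z , p , q) | z′ ∷ʳ′ y
    with ∷ʳ-injective u ((word Qs ++ C) ++ suc j ∷ z′)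
           (trans p (sym (++-assoc (word Qs ++ C) (suc j ∷ z′) [ y ])))
  ... | _ , refl with splitAt-++ D z′ (trans q (++-assoc z′ [ i ] (k ∷ ω)))
  ...   | inj₂ (c , p′ , _) = inj₂ (ascending c p′ sorted)
  ...   | inj₁ (v′ , refl , _) with AllPairs-++⁻ C sortedQ
  ...     | _ , (sj<D ∷ _) , _ = inj₁ (<-trans (n<1+n j) (All.head (All.++⁻ʳ z′ sj<D)))

staircase-normalForm : (σ : Permutation′ n) → Staircase Ps → word Ps IsDecompositionOf σ →
                       IsNormalForm _⟶_ (word Ps)
staircase-normalForm {Ps = Ps} σ st dec (_ , s) = refute refl s
  where
  minimal : w ⟶ w′ → word Ps ≡ w → ¬ (weight w′ < weight w)
  minimal {w′ = w′} s refl =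
    -- `w′` still decomposes `σ`, so it rewrites back to `word Ps`; as no rule increases the weight,
    -- it cannot be lighter.
    ≤⇒≯ (⟶*-weight (staircase-reach {w = w′} σ st dec (⟶*-decomposition σ (s ◅ ε) dec)))
  refute : word Ps ≡ w → w ⟶ w′ → ⊥
  refute eq s@(P1 u v i)     = minimal s eq (weight-cancel u v i)
  refute eq s@(P2 u v i ω _) = minimal s eq (weight-braid u v i ω)
  refute eq (P3 u v i ω d max) =
    ¬P3 u v i ω st (trans eq (trans (cong (u ++_) (++-assoc ω [ i ] v)) (sym (++-assoc u ω (i ∷ v)))))
      (dist>1⇒far i ω d) max
  refute eq (P4 u v i j k ω d side)
    with P4-order u i k ω st
           (trans eq (trans (cong (λ z → u ++ i ∷ k ∷ z) (++-assoc ω [ j ] v))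
             (sym (++-assoc u (i ∷ k ∷ ω) (j ∷ v)))))
           (dist>1⇒far j (k ∷ ω) d) | side
  ... | inj₁ j<i         | inj₁ (i≤j , _)   = ≤⇒≯ i≤j j<i
  ... | inj₁ j<i         | inj₂ (_ , i≤j)   = ≤⇒≯ i≤j j<i
  ... | inj₂ (_ , k<j)   | inj₁ (_ , j≤k)   = ≤⇒≯ j≤k k<j
  ... | inj₂ (i<k , _)   | inj₂ (k<i , _)   = <-asym i<k k<i

theorem7 : ∀ (n : ℕ) (σ : Permutation′ n) (ω : Word) → ω IsDecompositionOf σ →
    ∃[ β ] (β IsBubblianDecompositionOf σ
    × Star _⟶_ ω β
    × IsNormalForm _⟶_ β
    × (∀ ω′ → Star _⟶_ ω ω′ → Star _⟶_ ω′ β × (IsNormalForm _⟶_ ω′ → ω′ ≡ β)))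
theorem7 n σ ω dec with staircaseForm ω
... | Ps , st , ω⟶*β =
  word Ps , staircase⇒bubblian σ st decβ , ω⟶*β , staircase-normalForm σ st decβ , λ ω′ ω⟶*ω′ →
    -- Whatever is reached from `ω` decomposes `σ` and so rewrites to the same staircase; from a
    -- normal form this takes no step.
    let ω′⟶*β = staircase-reach σ st decβ (⟶*-decomposition σ ω⟶*ω′ dec)
    in ω′⟶*β , λ nf → normal⇒≡ nf ω′⟶*β
  where
  decβ : word Ps IsDecompositionOf σ
  decβ = ⟶*-decomposition σ ω⟶*β dec
  normal⇒≡ : IsNormalForm _⟶_ w → w ⟶* w′ → w ≡ w′
  normal⇒≡ nf ε       = refl
  normal⇒≡ nf (s ◅ _) = contradiction (_ , s) nf
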